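{- For all integers $n\ge0$, the sequence $(u_{ob}(m,n))_{m\in\mathbb{Z}}$ is symmetric and unimodal. Moreover, for all integers $m,n\ge0$, $u_{ob}(m,n)>u_{ob}(m+2,n)$ provided $u_{ob}(m,n)\ne0$.
   Context: $(a;q)_n=\prod_{0\le j<n}(1-aq^j)$, $(a,b;q)_n=(a;q)_n(b;q)_n$. The numbers $u_{ob}(m,n)$ (odd-balanced unimodal sequences of weight $2n+2$ and rank $m$) are defined by $$\sum_{n\ge0}\sum_{m\in\mathbb{Z}}u_{ob}(m,n)z^mq^n=\sum_{n\ge0}\frac{(-zq,-z^{ -1}q;q)_nq^n}{(q;q^2)_{n+1}}.$$ A two-sided sequence with finitely many nonzero terms is symmetric if its $m$-th and $(-m)$-th terms agree, and unimodal if, restricted to the smallest interval of indices containing all its nonzero terms, it first weakly increases and then weakly decreases. -}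

module Defs where

open import Data.Nat as ℕ using (ℕ; zero; suc)
open import Data.Nat.DivMod using (_%_)
open import Data.Integer as ℤ using (ℤ; +_; -_; _*_; _+_; _≤_)
open import Data.Product using (_×_; _,_; ∃; ∃-syntax)
open import Data.List using (List; []; _∷_; _++_; concatMap; map; upTo; foldr)
open import Relation.Nullary using (¬_; does)
open import Relation.Binary.PropositionalEquality using (_≡_)
open import Data.Bool using (if_then_else_)

-- Laurent polynomials in z with integer coefficients, as formal sums
-- of monomials (exponent , coefficient).

LPoly : Set
LPoly = List (ℤ × ℤ)

coeffZ : ℤ → LPoly → ℤ
coeffZ m []            = + 0
coeffZ m ((e , c) ∷ p) = (if does (e ℤ.≟ m) then c else + 0) + coeffZ m p

_⊗_ : LPoly → LPoly → LPoly
p ⊗ r = concatMap (λ { (e , c) → map (λ { (e' , c') → (e ℤ.+ e' , c * c') }) r }) p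

-- Formal power series in q whose coefficients are Laurent polynomials
-- in z:  f n  is the coefficient of q^n.

Series : Set
Series = ℕ → LPoly

sumTo : ℕ → (ℕ → LPoly) → LPoly
sumTo n f = foldr (λ i acc → f i ++ acc) [] (upTo (suc n))

_⊛_ : Series → Series → Series
(f ⊛ g) n = sumTo n (λ i → f i ⊗ g (n ℕ.∸ i))

oneS : Series
oneS zero    = (+ 0 , + 1) ∷ []
oneS (suc n) = []

monoS : ℤ → ℤ → ℕ → Series
monoS c e d n = if does (n ℕ.≟ d) then (e , c) ∷ [] else []

_⊕S_ : Series → Series → Series
(f ⊕S g) n = f n ++ g n

prodS : ℕ → (ℕ → Series) → Series
prodS zero    f = oneS
prodS (suc k) f = prodS k f ⊛ f k

pochPlusZ : ℕ → Series
pochPlusZ k = prodS k (λ j → oneS ⊕S monoS (+ 1) (+ 1) (suc j))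

pochMinusZ : ℕ → Series
pochMinusZ k = prodS k (λ j → oneS ⊕S monoS (+ 1) (- (+ 1)) (suc j))

-- 1 / (1 - q^(2j+1)) = Σ_{t ≥ 0} q^{(2j+1) t}
geomOdd : ℕ → Series
geomOdd j n = if does ((n % suc (2 ℕ.* j)) ℕ.≟ 0) then (+ 0 , + 1) ∷ [] else []

invQQ2 : ℕ → Series
invQQ2 k = prodS (suc k) geomOdd

summand : ℕ → Series
summand k = ((pochPlusZ k ⊛ pochMinusZ k) ⊛ monoS (+ 1) (+ 0) k) ⊛ invQQ2 k

-- The generating function  Σ_{k ≥ 0} summand k.  The k-th summand is
-- divisible by q^k, so the coefficient of q^n only involves k ≤ n.
genFun : Series
genFun n = sumTo n (λ k → summand k n)

u-ob : ℤ → ℕ → ℤ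
u-ob m n = coeffZ m (genFun n)

Symmetric : (ℤ → ℤ) → Set
Symmetric a = ∀ m → a m ≡ a (- m)

InHull : (ℤ → ℤ) → ℤ → Set
InHull a i = (∃[ l ] (¬ a l ≡ + 0 × l ≤ i)) × (∃[ r ] (¬ a r ≡ + 0 × i ≤ r))

Unimodal : (ℤ → ℤ) → Set
Unimodal a = ∃[ p ] (∀ i j → InHull a i → InHull a j → i ≤ j →
                       (j ≤ p → a i ≤ a j) × (p ≤ i → a j ≤ a i))

{-# OPTIONS --safe #-}

-- Since (q;q²)_{k+1} (-q;q)_k = (q^{k+1};q)_{k+1}, the k-th summand equals
--   q^k ∏_{j=1}^{k} (1 + q^j)(1 + z q^j)(1 + z⁻¹ q^j) / ((1 - q^{k+1}) ⋯ (1 - q^{2k+1})),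
-- and each factor of the product is 1 + χ (q^j + q^{2j}) + q^{3j} with χ = 1 + z + z⁻¹.
-- Multiplication by χ preserves the even sequences a ≥ 0 that decrease away from 0 and
-- satisfy a(m+2) < a(m) whenever a(m) ≠ 0. These sequences are closed under addition
-- and contain the coefficient sequence of 1, so every coefficient of q^n is of this kind.

module Submission where

open import Defs
open import Data.Nat using (ℕ)
open import Data.Integer using (ℤ; +_; _<_)
open import Data.Nat using () renaming (_+_ to _+ℕ_)
open import Data.Product using (_×_)
open import Relation.Nullary using (¬_)
open import Relation.Binary.PropositionalEquality using (_≡_)

open import Algebra using (CommutativeSemiring; IsCommutativeMonoid)
open import Algebra.Structures.Biased using (IsCommutativeSemiringˡ)
open import Data.Bool using (Bool; true; false; if_then_else_)
open import Data.Integer as ℤ using (-[1+_])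
import Data.Integer.Properties as ℤ
import Data.Integer.Tactic.RingSolver as ℤSolver
open import Data.List using ([]; _∷_; [_]; _++_; map; foldr; upTo)
import Data.List.Properties as List
open import Data.Nat as ℕ using (zero; suc; s≤s; z≤n)
open import Data.Nat.DivMod using (_%_; m<n⇒m%n≡m; [m+n]%n≡m%n)
import Data.Nat.Properties as ℕ
open import Data.Product using (_,_)
open import Function using (_∘_; _⇔_; mk⇔)
open import Relation.Binary using (IsEquivalence)
open import Relation.Binary.PropositionalEquality
  using (refl; sym; trans; cong; cong₂; subst; _≢_; module ≡-Reasoning)
import Relation.Binary.Reasoning.Setoid as SetoidReasoning
open import Relation.Nullary using (does; yes; no; contradiction)
open import Relation.Nullary.Decidable using (does-⇔)
import Algebra.Properties.AbelianGroup ℤ.+-0-abelianGroup as ℤ-Group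
import Algebra.Solver.Ring.NaturalCoefficients.Default
open import Level using (0ℓ)

-- Laurent polynomials in z

-- The linear functional sending `z^e` to `φ e`. Its value does not depend on how a Laurent
-- polynomial is listed as a formal sum, and coefficients are the case where `φ` is an indicator.
⟨_,_⟩ : LPoly → (ℤ → ℤ) → ℤ
⟨ []          , φ ⟩ = + 0
⟨ (e , c) ∷ p , φ ⟩ = c ℤ.* φ e ℤ.+ ⟨ p , φ ⟩

pair-cong : ∀ p {φ ψ} → (∀ e → φ e ≡ ψ e) → ⟨ p , φ ⟩ ≡ ⟨ p , ψ ⟩
pair-cong []            φ≗ψ = refl
pair-cong ((e , c) ∷ p) φ≗ψ = cong₂ ℤ._+_ (cong (c ℤ.*_) (φ≗ψ e)) (pair-cong p φ≗ψ)

pair-++ : ∀ p r φ → ⟨ p ++ r , φ ⟩ ≡ ⟨ p , φ ⟩ ℤ.+ ⟨ r , φ ⟩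
pair-++ []            r φ = sym (ℤ.+-identityˡ _)
pair-++ ((e , c) ∷ p) r φ =
  trans (cong (ℤ._+_ (c ℤ.* φ e)) (pair-++ p r φ)) (sym (ℤ.+-assoc (c ℤ.* φ e) _ _))

pair-0 : ∀ p → ⟨ p , (λ _ → + 0) ⟩ ≡ + 0
pair-0 []            = refl
pair-0 ((e , c) ∷ p) = cong₂ ℤ._+_ (ℤ.*-zeroʳ c) (pair-0 p)

pair-linear : ∀ p k φ ψ → ⟨ p , (λ e → k ℤ.* φ e ℤ.+ ψ e) ⟩ ≡ k ℤ.* ⟨ p , φ ⟩ ℤ.+ ⟨ p , ψ ⟩
pair-linear []            k φ ψ = sym (trans (ℤ.+-identityʳ _) (ℤ.*-zeroʳ k))
pair-linear ((e , c) ∷ p) k φ ψ =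
  trans (cong (ℤ._+_ (c ℤ.* (k ℤ.* φ e ℤ.+ ψ e))) (pair-linear p k φ ψ)) (rearrange c k (φ e) (ψ e) ⟨ p , φ ⟩ ⟨ p , ψ ⟩)
  where
  rearrange : ∀ c k x y s t → c ℤ.* (k ℤ.* x ℤ.+ y) ℤ.+ (k ℤ.* s ℤ.+ t)
                            ≡ k ℤ.* (c ℤ.* x ℤ.+ s) ℤ.+ (c ℤ.* y ℤ.+ t)
  rearrange = ℤSolver.solve-∀

-- Exchange of two finite sums, which is what commutativity of `⊗` rests on.
pair-swap : ∀ p r (Φ : ℤ → ℤ → ℤ) →
  ⟨ p , (λ e → ⟨ r , Φ e ⟩) ⟩ ≡ ⟨ r , (λ e′ → ⟨ p , (λ e → Φ e e′) ⟩) ⟩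
pair-swap []            r Φ = sym (pair-0 r)
pair-swap ((e , c) ∷ p) r Φ =
  trans (cong (ℤ._+_ (c ℤ.* ⟨ r , Φ e ⟩)) (pair-swap p r Φ)) (sym (pair-linear r c (Φ e) _))

-- The map `h` stands for the anonymous pattern-matching function inside `⊗`; it is known only
-- through its values on pairs.
pair-shift : ∀ e c (h : ℤ × ℤ → ℤ × ℤ) → (∀ e′ c′ → h (e′ , c′) ≡ (e ℤ.+ e′ , c ℤ.* c′)) →
  ∀ r φ → ⟨ map h r , φ ⟩ ≡ c ℤ.* ⟨ r , (λ e′ → φ (e ℤ.+ e′)) ⟩
pair-shift e c h h-shift []              φ = sym (ℤ.*-zeroʳ c)
pair-shift e c h h-shift ((e′ , c′) ∷ r) φ rewrite h-shift e′ c′ =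
  trans (cong₂ ℤ._+_ (ℤ.*-assoc c c′ _) (pair-shift e c h h-shift r φ))
        (sym (ℤ.*-distribˡ-+ c _ _))

-- Products become iterated pairings, so commutativity and associativity of `⊗` reduce to those of
-- adding exponents.
pair-⊗ : ∀ p r φ → ⟨ p ⊗ r , φ ⟩ ≡ ⟨ p , (λ e → ⟨ r , (λ e′ → φ (e ℤ.+ e′)) ⟩) ⟩
pair-⊗ []            r φ = refl
pair-⊗ ((e , c) ∷ p) r φ =
  trans (pair-++ (map _ r) (p ⊗ r) φ)
        (cong₂ ℤ._+_ (pair-shift e c _ (λ _ _ → refl) r φ) (pair-⊗ p r φ))

-- Equality against all test functions, rather than coefficientwise: it makes
-- ⊗ a congruence without any finite-support argument.
record _≋_ (p r : LPoly) : Set where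
  constructor mk≋
  field pairing : ∀ φ → ⟨ p , φ ⟩ ≡ ⟨ r , φ ⟩
open _≋_

infix 4 _≋_

≋-isEquivalence : IsEquivalence _≋_
≋-isEquivalence = record
  { refl  = mk≋ λ φ → refl
  ; sym   = λ p≋r → mk≋ λ φ → sym (pairing p≋r φ)
  ; trans = λ p≋r r≋s → mk≋ λ φ → trans (pairing p≋r φ) (pairing r≋s φ)
  }

++-isCommutativeMonoid : IsCommutativeMonoid _≋_ _++_ []
++-isCommutativeMonoid = record
  { isMonoid = record
    { isSemigroup = record
      { isMagma = record
        { isEquivalence = ≋-isEquivalence
        ; ∙-cong = λ {p} {p′} {r} {r′} p≋p′ r≋r′ → mk≋ λ φ →
            trans (pair-++ p r φ)
                  (trans (cong₂ ℤ._+_ (pairing p≋p′ φ) (pairing r≋r′ φ)) (sym (pair-++ p′ r′ φ)))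
        }
      ; assoc = λ p r s → mk≋ λ φ → cong ⟨_, φ ⟩ (List.++-assoc p r s)
      }
    ; identity = (λ p → mk≋ λ φ → refl) , (λ p → mk≋ λ φ → cong ⟨_, φ ⟩ (List.++-identityʳ p))
    }
  ; comm = λ p r → mk≋ λ φ →
      trans (pair-++ p r φ) (trans (ℤ.+-comm ⟨ p , φ ⟩ ⟨ r , φ ⟩) (sym (pair-++ r p φ)))
  }

⊗-comm : ∀ p r → p ⊗ r ≋ r ⊗ p
⊗-comm p r = mk≋ λ φ → begin
  ⟨ p ⊗ r , φ ⟩                                ≡⟨ pair-⊗ p r φ ⟩
  ⟨ p , (λ e → ⟨ r , (λ e′ → φ (e ℤ.+ e′)) ⟩) ⟩  ≡⟨ pair-swap p r _ ⟩
  ⟨ r , (λ e′ → ⟨ p , (λ e → φ (e ℤ.+ e′)) ⟩) ⟩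
    ≡⟨ pair-cong r (λ e′ → pair-cong p λ e → cong φ (ℤ.+-comm e e′)) ⟩
  ⟨ r , (λ e′ → ⟨ p , (λ e → φ (e′ ℤ.+ e)) ⟩) ⟩  ≡⟨ pair-⊗ r p φ ⟨
  ⟨ r ⊗ p , φ ⟩                                ∎
  where open ≡-Reasoning

⊗-assoc : ∀ p r s → (p ⊗ r) ⊗ s ≋ p ⊗ (r ⊗ s)
⊗-assoc p r s = mk≋ λ φ → begin
  ⟨ (p ⊗ r) ⊗ s , φ ⟩                               ≡⟨ pair-⊗ (p ⊗ r) s φ ⟩
  ⟨ p ⊗ r , (λ d → ⟨ s , (λ e″ → φ (d ℤ.+ e″)) ⟩) ⟩  ≡⟨ pair-⊗ p r _ ⟩
  ⟨ p , (λ e → ⟨ r , (λ e′ → ⟨ s , (λ e″ → φ ((e ℤ.+ e′) ℤ.+ e″)) ⟩) ⟩) ⟩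
    ≡⟨ pair-cong p (λ e → pair-cong r λ e′ → pair-cong s λ e″ → cong φ (ℤ.+-assoc e e′ e″)) ⟩
  ⟨ p , (λ e → ⟨ r , (λ e′ → ⟨ s , (λ e″ → φ (e ℤ.+ (e′ ℤ.+ e″))) ⟩) ⟩) ⟩
    ≡⟨ pair-cong p (λ e → pair-⊗ r s (λ d → φ (e ℤ.+ d))) ⟨
  ⟨ p , (λ e → ⟨ r ⊗ s , (λ d → φ (e ℤ.+ d)) ⟩) ⟩    ≡⟨ pair-⊗ p (r ⊗ s) φ ⟨
  ⟨ p ⊗ (r ⊗ s) , φ ⟩                               ∎
  where open ≡-Reasoning

⊗-cong : ∀ {p p′ r r′} → p ≋ p′ → r ≋ r′ → p ⊗ r ≋ p′ ⊗ r′
⊗-cong {p} {p′} {r} {r′} p≋p′ r≋r′ = mk≋ λ φ → begin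
  ⟨ p ⊗ r , φ ⟩                                     ≡⟨ pair-⊗ p r φ ⟩
  ⟨ p , (λ e → ⟨ r , (λ e′ → φ (e ℤ.+ e′)) ⟩) ⟩      ≡⟨ pairing p≋p′ _ ⟩
  ⟨ p′ , (λ e → ⟨ r , (λ e′ → φ (e ℤ.+ e′)) ⟩) ⟩     ≡⟨ pair-cong p′ (λ e → pairing r≋r′ _) ⟩
  ⟨ p′ , (λ e → ⟨ r′ , (λ e′ → φ (e ℤ.+ e′)) ⟩) ⟩    ≡⟨ pair-⊗ p′ r′ φ ⟨
  ⟨ p′ ⊗ r′ , φ ⟩                                   ∎
  where open ≡-Reasoning

pair-1 : ∀ φ → ⟨ [ + 0 , + 1 ] , φ ⟩ ≡ φ (+ 0)
pair-1 φ = trans (ℤ.+-identityʳ _) (ℤ.*-identityˡ (φ (+ 0)))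

⊗-identityˡ : ∀ p → [ + 0 , + 1 ] ⊗ p ≋ p
⊗-identityˡ p = mk≋ λ φ →
  trans (pair-⊗ [ + 0 , + 1 ] p φ)
        (trans (pair-1 (λ e → ⟨ p , (λ e′ → φ (e ℤ.+ e′)) ⟩)) (pair-cong p λ e → cong φ (ℤ.+-identityˡ e)))

⊗-distribʳ : ∀ s p r → (p ++ r) ⊗ s ≋ (p ⊗ s) ++ (r ⊗ s)
⊗-distribʳ s p r = mk≋ λ φ → begin
  ⟨ (p ++ r) ⊗ s , φ ⟩               ≡⟨ pair-⊗ (p ++ r) s φ ⟩
  ⟨ p ++ r , _ ⟩                     ≡⟨ pair-++ p r _ ⟩
  ⟨ p , _ ⟩ ℤ.+ ⟨ r , _ ⟩             ≡⟨ cong₂ ℤ._+_ (pair-⊗ p s φ) (pair-⊗ r s φ) ⟨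
  ⟨ p ⊗ s , φ ⟩ ℤ.+ ⟨ r ⊗ s , φ ⟩     ≡⟨ pair-++ (p ⊗ s) (r ⊗ s) φ ⟨
  ⟨ (p ⊗ s) ++ (r ⊗ s) , φ ⟩         ∎
  where open ≡-Reasoning

LPoly-commutativeSemiring : CommutativeSemiring 0ℓ 0ℓ
LPoly-commutativeSemiring = record
  { Carrier = LPoly ; _≈_ = _≋_ ; _+_ = _++_ ; _*_ = _⊗_ ; 0# = [] ; 1# = [ + 0 , + 1 ]
  ; isCommutativeSemiring = IsCommutativeSemiringˡ.isCommutativeSemiring (record
    { +-isCommutativeMonoid = ++-isCommutativeMonoid
    ; *-isCommutativeMonoid = record
      { isMonoid = record
        { isSemigroup = record
          { isMagma = record { isEquivalence = ≋-isEquivalence ; ∙-cong = ⊗-cong }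
          ; assoc = ⊗-assoc
          }
        ; identity = ⊗-identityˡ
                   , λ p → IsEquivalence.trans ≋-isEquivalence (⊗-comm p _) (⊗-identityˡ p)
        }
      ; comm = ⊗-comm
      }
    ; distribʳ = ⊗-distribʳ
    ; zeroˡ = λ p → mk≋ λ φ → refl
    })
  }

module L = CommutativeSemiring LPoly-commutativeSemiring

open import Algebra.Properties.CommutativeSemigroup L.+-commutativeSemigroup using (interchange)

-- Power series in q

sumTo-suc : ∀ n f → sumTo (suc n) f ≡ f 0 ++ sumTo n (f ∘ suc)
sumTo-suc n f = cong (f 0 ++_)
  (trans (cong (foldr prepend []) (sym (List.map-upTo suc (suc n))))
         (List.foldr-map prepend suc [] (upTo (suc n))))
  where
  prepend : ℕ → LPoly → LPoly
  prepend i acc = f i ++ acc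

tail : Series → Series
tail f = f ∘ suc

⊛-zero : ∀ f g → (f ⊛ g) 0 ≋ f 0 ⊗ g 0
⊛-zero f g = L.+-identityʳ (f 0 ⊗ g 0)

-- Comes from writing `f` as its constant term plus `q` times `tail f`. The laws of `⊛` then follow
-- by induction on the degree, with the left factor varying.
⊛-suc : ∀ f g n → (f ⊛ g) (suc n) ≋ f 0 ⊗ g (suc n) ++ (tail f ⊛ g) n
⊛-suc f g n = L.reflexive (sumTo-suc n (λ i → f i ⊗ g (suc n ℕ.∸ i)))

record _≈_ (f g : Series) : Set where
  constructor mk≈
  field at : ∀ n → f n ≋ g n
open _≈_

infix 4 _≈_

≈-isEquivalence : IsEquivalence _≈_
≈-isEquivalence = record
  { refl  = mk≈ λ n → L.refl
  ; sym   = λ f≈g → mk≈ λ n → L.sym (at f≈g n)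
  ; trans = λ f≈g g≈h → mk≈ λ n → L.trans (at f≈g n) (at g≈h n)
  }

zeroS : Series
zeroS n = []

module _ where
  open SetoidReasoning L.setoid

  ⊛-cong : ∀ {f f′ g g′} → f ≈ f′ → g ≈ g′ → f ⊛ g ≈ f′ ⊛ g′
  ⊛-cong {g = g} {g′} f≈f′ g≈g′ = mk≈ λ n → go n f≈f′
    where
    go : ∀ n {f f′} → f ≈ f′ → (f ⊛ g) n ≋ (f′ ⊛ g′) n
    go zero    f≈f′ = L.+-cong (L.*-cong (at f≈f′ 0) (at g≈g′ 0)) L.refl
    go (suc n) {f} {f′} f≈f′ = begin
      (f ⊛ g) (suc n)                            ≈⟨ ⊛-suc f g n ⟩
      f 0 ⊗ g (suc n) ++ (tail f ⊛ g) n
        ≈⟨ L.+-cong (L.*-cong (at f≈f′ 0) (at g≈g′ (suc n))) (go n (mk≈ (at f≈f′ ∘ suc))) ⟩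
      f′ 0 ⊗ g′ (suc n) ++ (tail f′ ⊛ g′) n      ≈⟨ ⊛-suc f′ g′ n ⟨
      (f′ ⊛ g′) (suc n)                          ∎

  ⊛-distribʳ : ∀ h f g → (f ⊕S g) ⊛ h ≈ (f ⊛ h) ⊕S (g ⊛ h)
  ⊛-distribʳ h f g = mk≈ λ n → go n f g
    where
    go : ∀ n f g → ((f ⊕S g) ⊛ h) n ≋ (f ⊛ h) n ++ (g ⊛ h) n
    go zero f g = begin
      ((f ⊕S g) ⊛ h) 0             ≈⟨ ⊛-zero (f ⊕S g) h ⟩
      (f 0 ++ g 0) ⊗ h 0           ≈⟨ L.distribʳ (h 0) (f 0) (g 0) ⟩
      f 0 ⊗ h 0 ++ g 0 ⊗ h 0       ≈⟨ L.+-cong (⊛-zero f h) (⊛-zero g h) ⟨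
      (f ⊛ h) 0 ++ (g ⊛ h) 0       ∎
    go (suc n) f g = begin
      ((f ⊕S g) ⊛ h) (suc n)
        ≈⟨ ⊛-suc (f ⊕S g) h n ⟩
      (f 0 ++ g 0) ⊗ h (suc n) ++ ((tail f ⊕S tail g) ⊛ h) n
        ≈⟨ L.+-cong (L.distribʳ (h (suc n)) (f 0) (g 0)) (go n (tail f) (tail g)) ⟩
      (f 0 ⊗ h (suc n) ++ g 0 ⊗ h (suc n)) ++ ((tail f ⊛ h) n ++ (tail g ⊛ h) n)
        ≈⟨ interchange (f 0 ⊗ h (suc n)) (g 0 ⊗ h (suc n)) ((tail f ⊛ h) n) ((tail g ⊛ h) n) ⟩
      (f 0 ⊗ h (suc n) ++ (tail f ⊛ h) n) ++ (g 0 ⊗ h (suc n) ++ (tail g ⊛ h) n)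
        ≈⟨ L.+-cong (⊛-suc f h n) (⊛-suc g h n) ⟨
      (f ⊛ h) (suc n) ++ (g ⊛ h) (suc n) ∎

  ⊛-zeroˡ : ∀ g → zeroS ⊛ g ≈ zeroS
  ⊛-zeroˡ g = mk≈ go
    where
    go : ∀ n → (zeroS ⊛ g) n ≋ []
    go zero    = ⊛-zero zeroS g
    go (suc n) = L.trans (⊛-suc zeroS g n) (go n)

  ⊛-scaleˡ : ∀ p f g → (λ n → p ⊗ f n) ⊛ g ≈ (λ n → p ⊗ (f ⊛ g) n)
  ⊛-scaleˡ p f g = mk≈ λ n → go n f
    where
    go : ∀ n f → ((λ n → p ⊗ f n) ⊛ g) n ≋ p ⊗ (f ⊛ g) n
    go zero f = begin
      ((λ n → p ⊗ f n) ⊛ g) 0    ≈⟨ ⊛-zero (λ n → p ⊗ f n) g ⟩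
      (p ⊗ f 0) ⊗ g 0            ≈⟨ L.*-assoc p (f 0) (g 0) ⟩
      p ⊗ (f 0 ⊗ g 0)            ≈⟨ L.*-congˡ {p} (⊛-zero f g) ⟨
      p ⊗ (f ⊛ g) 0              ∎
    go (suc n) f = begin
      ((λ n → p ⊗ f n) ⊛ g) (suc n)
        ≈⟨ ⊛-suc (λ n → p ⊗ f n) g n ⟩
      (p ⊗ f 0) ⊗ g (suc n) ++ ((λ n → p ⊗ tail f n) ⊛ g) n
        ≈⟨ L.+-cong (L.*-assoc p (f 0) (g (suc n))) (go n (tail f)) ⟩
      (p ⊗ (f 0 ⊗ g (suc n))) ++ (p ⊗ (tail f ⊛ g) n)
        ≈⟨ L.distribˡ p (f 0 ⊗ g (suc n)) ((tail f ⊛ g) n) ⟨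
      p ⊗ (f 0 ⊗ g (suc n) ++ (tail f ⊛ g) n)
        ≈⟨ L.*-congˡ {p} (⊛-suc f g n) ⟨
      p ⊗ (f ⊛ g) (suc n) ∎

  -- The mirror image of `⊛-suc`, peeling the right factor; commutativity matches the two
  -- recursions.
  ⊛-suc′ : ∀ f g n → (f ⊛ g) (suc n) ≋ (f ⊛ tail g) n ++ f (suc n) ⊗ g 0
  ⊛-suc′ f g zero = begin
    (f ⊛ g) 1                            ≈⟨ ⊛-suc f g 0 ⟩
    f 0 ⊗ g 1 ++ (tail f ⊛ g) 0          ≈⟨ L.+-cong (⊛-zero f (tail g)) (L.sym (⊛-zero (tail f) g)) ⟨
    (f ⊛ tail g) 0 ++ f 1 ⊗ g 0          ∎
  ⊛-suc′ f g (suc n) = begin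
    (f ⊛ g) (suc (suc n))
      ≈⟨ ⊛-suc f g (suc n) ⟩
    f 0 ⊗ g (suc (suc n)) ++ (tail f ⊛ g) (suc n)
      ≈⟨ L.+-congˡ {f 0 ⊗ g (suc (suc n))} (⊛-suc′ (tail f) g n) ⟩
    f 0 ⊗ g (suc (suc n)) ++ ((tail f ⊛ tail g) n ++ f (suc (suc n)) ⊗ g 0)
      ≈⟨ L.+-assoc (f 0 ⊗ g (suc (suc n))) ((tail f ⊛ tail g) n) (f (suc (suc n)) ⊗ g 0) ⟨
    (f 0 ⊗ g (suc (suc n)) ++ (tail f ⊛ tail g) n) ++ f (suc (suc n)) ⊗ g 0
      ≈⟨ L.+-congʳ (⊛-suc f (tail g) n) ⟨
    (f ⊛ tail g) (suc n) ++ f (suc (suc n)) ⊗ g 0 ∎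

  ⊛-comm : ∀ f g → f ⊛ g ≈ g ⊛ f
  ⊛-comm f g = mk≈ λ n → go n f
    where
    go : ∀ n f → (f ⊛ g) n ≋ (g ⊛ f) n
    go zero f = begin
      (f ⊛ g) 0     ≈⟨ ⊛-zero f g ⟩
      f 0 ⊗ g 0     ≈⟨ L.*-comm (f 0) (g 0) ⟩
      g 0 ⊗ f 0     ≈⟨ ⊛-zero g f ⟨
      (g ⊛ f) 0     ∎
    go (suc n) f = begin
      (f ⊛ g) (suc n)                       ≈⟨ ⊛-suc f g n ⟩
      f 0 ⊗ g (suc n) ++ (tail f ⊛ g) n     ≈⟨ L.+-cong (L.*-comm (f 0) (g (suc n))) (go n (tail f)) ⟩
      g (suc n) ⊗ f 0 ++ (g ⊛ tail f) n     ≈⟨ L.+-comm (g (suc n) ⊗ f 0) ((g ⊛ tail f) n) ⟩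
      (g ⊛ tail f) n ++ g (suc n) ⊗ f 0     ≈⟨ ⊛-suc′ g f n ⟨
      (g ⊛ f) (suc n)                       ∎

  -- The tail of `f ⊛ g` is a scalar multiple of `tail g` plus `tail f ⊛ g`. `⊛-scaleˡ` handles the
  -- first piece and the induction hypothesis the second.
  ⊛-assoc : ∀ f g h → (f ⊛ g) ⊛ h ≈ f ⊛ (g ⊛ h)
  ⊛-assoc f g h = mk≈ λ n → go n f
    where
    tail-⊛ : ∀ f → tail (f ⊛ g) ≈ (λ n → f 0 ⊗ g (suc n)) ⊕S (tail f ⊛ g)
    tail-⊛ f = mk≈ (⊛-suc f g)
    go : ∀ n f → ((f ⊛ g) ⊛ h) n ≋ (f ⊛ (g ⊛ h)) n
    go zero f = begin
      ((f ⊛ g) ⊛ h) 0        ≈⟨ ⊛-zero (f ⊛ g) h ⟩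
      (f ⊛ g) 0 ⊗ h 0        ≈⟨ L.*-congʳ (⊛-zero f g) ⟩
      (f 0 ⊗ g 0) ⊗ h 0      ≈⟨ L.*-assoc (f 0) (g 0) (h 0) ⟩
      f 0 ⊗ (g 0 ⊗ h 0)      ≈⟨ L.*-congˡ {f 0} (⊛-zero g h) ⟨
      f 0 ⊗ (g ⊛ h) 0        ≈⟨ ⊛-zero f (g ⊛ h) ⟨
      (f ⊛ (g ⊛ h)) 0        ∎
    go (suc n) f = begin
      ((f ⊛ g) ⊛ h) (suc n)
        ≈⟨ ⊛-suc (f ⊛ g) h n ⟩
      (f ⊛ g) 0 ⊗ h (suc n) ++ (tail (f ⊛ g) ⊛ h) n
        ≈⟨ L.+-cong (L.trans (L.*-congʳ (⊛-zero f g)) (L.*-assoc (f 0) (g 0) (h (suc n))))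
                    (L.trans (at (⊛-cong (tail-⊛ f) (mk≈ {h} λ _ → L.refl)) n)
                             (at (⊛-distribʳ h (λ n → f 0 ⊗ g (suc n)) (tail f ⊛ g)) n)) ⟩
      (f 0 ⊗ (g 0 ⊗ h (suc n))) ++ (((λ n → f 0 ⊗ g (suc n)) ⊛ h) n ++ ((tail f ⊛ g) ⊛ h) n)
        ≈⟨ L.+-congˡ {f 0 ⊗ (g 0 ⊗ h (suc n))}
             (L.+-cong (at (⊛-scaleˡ (f 0) (tail g) h) n) (go n (tail f))) ⟩
      (f 0 ⊗ (g 0 ⊗ h (suc n))) ++ ((f 0 ⊗ (tail g ⊛ h) n) ++ (tail f ⊛ (g ⊛ h)) n)
        ≈⟨ L.+-assoc (f 0 ⊗ (g 0 ⊗ h (suc n))) (f 0 ⊗ (tail g ⊛ h) n) ((tail f ⊛ (g ⊛ h)) n) ⟨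
      ((f 0 ⊗ (g 0 ⊗ h (suc n))) ++ (f 0 ⊗ (tail g ⊛ h) n)) ++ (tail f ⊛ (g ⊛ h)) n
        ≈⟨ L.+-congʳ (L.distribˡ (f 0) (g 0 ⊗ h (suc n)) ((tail g ⊛ h) n)) ⟨
      (f 0 ⊗ (g 0 ⊗ h (suc n) ++ (tail g ⊛ h) n)) ++ (tail f ⊛ (g ⊛ h)) n
        ≈⟨ L.+-congʳ (L.*-congˡ {f 0} (⊛-suc g h n)) ⟨
      f 0 ⊗ (g ⊛ h) (suc n) ++ (tail f ⊛ (g ⊛ h)) n
        ≈⟨ ⊛-suc f (g ⊛ h) n ⟨
      (f ⊛ (g ⊛ h)) (suc n) ∎

  monoS-0-⊛ : ∀ c e f n → (monoS c e 0 ⊛ f) n ≋ [ e , c ] ⊗ f n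
  monoS-0-⊛ c e f zero    = ⊛-zero (monoS c e 0) f
  monoS-0-⊛ c e f (suc n) = begin
    (monoS c e 0 ⊛ f) (suc n)                      ≈⟨ ⊛-suc (monoS c e 0) f n ⟩
    [ e , c ] ⊗ f (suc n) ++ (zeroS ⊛ f) n
      ≈⟨ L.+-congˡ {[ e , c ] ⊗ f (suc n)} (at (⊛-zeroˡ f) n) ⟩
    [ e , c ] ⊗ f (suc n) ++ []                    ≈⟨ L.+-identityʳ ([ e , c ] ⊗ f (suc n)) ⟩
    [ e , c ] ⊗ f (suc n)                          ∎

  monoS-⊛-+ : ∀ c e d f n → (monoS c e d ⊛ f) (d ℕ.+ n) ≋ [ e , c ] ⊗ f n
  monoS-⊛-+ c e zero    f n = monoS-0-⊛ c e f n
  monoS-⊛-+ c e (suc d) f n =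
    -- By computation, `monoS c e (suc d)` has constant term `[]` and tail `monoS c e d`.
    L.trans (⊛-suc (monoS c e (suc d)) f (d ℕ.+ n)) (monoS-⊛-+ c e d f n)

  monoS-⊛-< : ∀ c e d f {n} → n ℕ.< d → (monoS c e d ⊛ f) n ≋ []
  monoS-⊛-< c e (suc d) f {zero}  n<d       = ⊛-zero (monoS c e (suc d)) f
  monoS-⊛-< c e (suc d) f {suc n} (s≤s n<d) =
    L.trans (⊛-suc (monoS c e (suc d)) f n) (monoS-⊛-< c e d f n<d)

  monoS-⊛-monoS : ∀ c e d c′ e′ d′ →
    monoS c e d ⊛ monoS c′ e′ d′ ≈ monoS (c ℤ.* c′) (e ℤ.+ e′) (d ℕ.+ d′)
  monoS-⊛-monoS c e d c′ e′ d′ = mk≈ (go d)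
    where
    go : ∀ d n → (monoS c e d ⊛ monoS c′ e′ d′) n ≋ monoS (c ℤ.* c′) (e ℤ.+ e′) (d ℕ.+ d′) n
    go zero n = L.trans (monoS-0-⊛ c e (monoS c′ e′ d′) n) (scale (does (n ℕ.≟ d′)))
      where
      scale : ∀ b → [ e , c ] ⊗ (if b then [ e′ , c′ ] else [])
                  ≋ (if b then [ e ℤ.+ e′ , c ℤ.* c′ ] else [])
      scale true  = L.refl
      scale false = L.refl
    go (suc d) zero    = ⊛-zero (monoS c e (suc d)) (monoS c′ e′ d′)
    go (suc d) (suc n) = L.trans (⊛-suc (monoS c e (suc d)) (monoS c′ e′ d′) n) (go d n)

oneS≈monoS : oneS ≈ monoS (+ 1) (+ 0) 0
oneS≈monoS = mk≈ λ { zero → L.refl ; (suc n) → L.refl }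

⊛-identityˡ : ∀ f → oneS ⊛ f ≈ f
⊛-identityˡ f = mk≈ λ n →
  L.trans (at (⊛-cong oneS≈monoS (mk≈ {f} λ _ → L.refl)) n)
          (L.trans (monoS-0-⊛ (+ 1) (+ 0) f n) (L.*-identityˡ (f n)))

Series-commutativeSemiring : CommutativeSemiring 0ℓ 0ℓ
Series-commutativeSemiring = record
  { Carrier = Series ; _≈_ = _≈_ ; _+_ = _⊕S_ ; _*_ = _⊛_ ; 0# = zeroS ; 1# = oneS
  ; isCommutativeSemiring = IsCommutativeSemiringˡ.isCommutativeSemiring (record
    { +-isCommutativeMonoid = record
      { isMonoid = record
        { isSemigroup = record
          { isMagma = record
            { isEquivalence = ≈-isEquivalence
            ; ∙-cong = λ f≈f′ g≈g′ → mk≈ λ n → L.+-cong (at f≈f′ n) (at g≈g′ n)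
            }
          ; assoc = λ f g h → mk≈ λ n → L.+-assoc (f n) (g n) (h n)
          }
        ; identity = (λ f → mk≈ λ n → L.+-identityˡ (f n)) , (λ f → mk≈ λ n → L.+-identityʳ (f n))
        }
      ; comm = λ f g → mk≈ λ n → L.+-comm (f n) (g n)
      }
    ; *-isCommutativeMonoid = record
      { isMonoid = record
        { isSemigroup = record
          { isMagma = record { isEquivalence = ≈-isEquivalence ; ∙-cong = ⊛-cong }
          ; assoc = ⊛-assoc
          }
        ; identity = ⊛-identityˡ
                   , λ f → IsEquivalence.trans ≈-isEquivalence (⊛-comm f oneS) (⊛-identityˡ f)
        }
      ; comm = ⊛-comm
      }
    ; distribʳ = ⊛-distribʳ
    ; zeroˡ = ⊛-zeroˡ
    })
  }

module S = CommutativeSemiring Series-commutativeSemiring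

-- Rewriting the summands

module _ {c ℓ} (R : CommutativeSemiring c ℓ) where
  open CommutativeSemiring R renaming (_≈_ to _≈′_; refl to ≈-refl; sym to ≈-sym; trans to ≈-trans)
  open import Algebra.Solver.Ring.NaturalCoefficients.Default R

  -- In a ring: g = (1 - a)⁻¹ and h = (1 - a²)⁻¹, so g = (1 + a) h.
  geometric-double : (∀ {x y z} → x + z ≈′ y + z → x ≈′ y) → ∀ {a g h} →
    g ≈′ 1# + a * g → h ≈′ 1# + (a * a) * h → g ≈′ (1# + a) * h
  -- Adding `g * ((a * a) * h)` to both sides avoids subtraction: each side becomes `g * h`, the
  -- left one by `h-eq` and the right one by using `g-eq` twice.
  geometric-double +-cancelʳ {a} {g} {h} g-eq h-eq = +-cancelʳ (begin
    g + g * ((a * a) * h)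
      ≈⟨ solve 3 (λ a g h → g :+ g :* ((a :* a) :* h)
                         := g :* (con 1 :+ (a :* a) :* h)) ≈-refl a g h ⟩
    g * (1# + (a * a) * h)             ≈⟨ *-congˡ h-eq ⟨
    g * h                              ≈⟨ *-congʳ g-eq ⟩
    (1# + a * g) * h
      ≈⟨ solve 3 (λ a g h → (con 1 :+ a :* g) :* h := h :+ (a :* h) :* g) ≈-refl a g h ⟩
    h + (a * h) * g                    ≈⟨ +-congˡ (*-congˡ g-eq) ⟩
    h + (a * h) * (1# + a * g)
      ≈⟨ solve 3 (λ a g h → h :+ (a :* h) :* (con 1 :+ a :* g)
                         := (con 1 :+ a) :* h :+ g :* ((a :* a) :* h)) ≈-refl a g h ⟩
    (1# + a) * h + g * ((a * a) * h)   ∎)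
    where open SetoidReasoning setoid

  -- The coefficients of `a` and `a * a` are `1# + y + w` and `y + w + y * w`. They coincide once
  -- `y * w` is one, so only this single combination of `y` and `w` survives.
  triple-product : ∀ a {y w} → y * w ≈′ 1# →
    ((1# + a) * (1# + y * a)) * (1# + w * a)
      ≈′ 1# + (((1# + y) + w) * (a + a * a) + a * (a * a))
  triple-product a {y} {w} yw≈1 = begin
    -- The solver does not know that `y * w` is one, so this factor is first isolated, then
    -- replaced.
    ((1# + a) * (1# + y * a)) * (1# + w * a)
      ≈⟨ solve 3 (λ a y w → ((con 1 :+ a) :* (con 1 :+ y :* a)) :* (con 1 :+ w :* a)
                         := con 1 :+ (((con 1 :+ y) :+ w) :* a :+ ((y :+ w) :* (a :* a)
                                      :+ (y :* w) :* (a :* a :+ a :* (a :* a))))) ≈-refl a y w ⟩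
    1# + (((1# + y) + w) * a + ((y + w) * (a * a) + (y * w) * (a * a + a * (a * a))))
      ≈⟨ +-congˡ (+-congˡ (+-congˡ (*-congʳ yw≈1))) ⟩
    1# + (((1# + y) + w) * a + ((y + w) * (a * a) + 1# * (a * a + a * (a * a))))
      ≈⟨ solve 3 (λ a y w → con 1 :+ (((con 1 :+ y) :+ w) :* a :+ ((y :+ w) :* (a :* a)
                                      :+ con 1 :* (a :* a :+ a :* (a :* a))))
                         := con 1 :+ (((con 1 :+ y) :+ w) :* (a :+ a :* a) :+ a :* (a :* a))) ≈-refl a y w ⟩
    1# + (((1# + y) + w) * (a + a * a) + a * (a * a)) ∎
    where open SetoidReasoning setoid

-- The semiring structure provides no subtraction; cancellation is inherited from the integers
-- through the pairing.
⊕S-cancelʳ : ∀ {f g h} → f ⊕S h ≈ g ⊕S h → f ≈ g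
⊕S-cancelʳ {f} {g} {h} eq = mk≈ λ n → mk≋ λ φ → ℤ-Group.∙-cancelʳ ⟨ h n , φ ⟩ _ _ (begin
  ⟨ f n , φ ⟩ ℤ.+ ⟨ h n , φ ⟩   ≡⟨ pair-++ (f n) (h n) φ ⟨
  ⟨ f n ++ h n , φ ⟩            ≡⟨ pairing (at eq n) φ ⟩
  ⟨ g n ++ h n , φ ⟩            ≡⟨ pair-++ (g n) (h n) φ ⟩
  ⟨ g n , φ ⟩ ℤ.+ ⟨ h n , φ ⟩   ∎)
  where open ≡-Reasoning

-- Geometric series and the denominators

q^ : ℕ → Series
q^ = monoS (+ 1) (+ 0)

-- 1 / (1 - q^(d+1))
geom : ℕ → Series
geom d n = if does ((n % suc d) ℕ.≟ 0) then [ + 0 , + 1 ] else []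

geom-unfold : ∀ d → geom d ≈ oneS ⊕S (q^ (suc d) ⊛ geom d)
geom-unfold d = mk≈ go
  where
  go : ∀ n → geom d n ≋ oneS n ++ (q^ (suc d) ⊛ geom d) n
  go zero = L.sym (L.+-congˡ {[ + 0 , + 1 ]} (monoS-⊛-< (+ 1) (+ 0) (suc d) (geom d) (s≤s z≤n)))
  -- Below the period the remainder is `suc n` itself, hence nonzero, and the shifted series still
  -- vanishes. From the period on, both sides agree by periodicity of the remainder.
  go (suc n) with suc n ℕ.<? suc d
  ... | yes n<d = L.trans
    (L.reflexive (cong (λ r → if does (r ℕ.≟ 0) then [ + 0 , + 1 ] else []) (m<n⇒m%n≡m n<d)))
    (L.sym (monoS-⊛-< (+ 1) (+ 0) (suc d) (geom d) n<d))
  ... | no n≮d = subst (λ m → geom d m ≋ (q^ (suc d) ⊛ geom d) m) (ℕ.m+[n∸m]≡n (ℕ.≮⇒≥ n≮d)) (periodic _)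
    where
    periodic : ∀ k → geom d (suc d ℕ.+ k) ≋ (q^ (suc d) ⊛ geom d) (suc d ℕ.+ k)
    periodic k = L.trans
      (L.reflexive (cong (λ r → if does (r ℕ.≟ 0) then [ + 0 , + 1 ] else [])
        (trans (cong (_% suc d) (ℕ.+-comm (suc d) k)) ([m+n]%n≡m%n k (suc d)))))
      (L.sym (L.trans (monoS-⊛-+ (+ 1) (+ 0) (suc d) (geom d) k) (L.*-identityˡ (geom d k))))

-- This is 1/(1 - a) = (1 + a)/(1 - a²) for a = q^(d+1). As `geom` is offset by one, the exponent
-- 2(d+1) has index `d + suc d`.
geom-double : ∀ d → geom d ≈ (oneS ⊕S q^ (suc d)) ⊛ geom (d ℕ.+ suc d)
geom-double d = geometric-double Series-commutativeSemiring ⊕S-cancelʳ (geom-unfold d)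
  (S.trans (geom-unfold (d ℕ.+ suc d))
    (S.+-congˡ {oneS} (S.*-congʳ {geom (d ℕ.+ suc d)} (S.sym (monoS-⊛-monoS (+ 1) (+ 0) (suc d) (+ 1) (+ 0) (suc d))))))

prodS-cong : ∀ k {f g} → (∀ j → f j ≈ g j) → prodS k f ≈ prodS k g
prodS-cong zero    f≈g = S.refl
prodS-cong (suc k) f≈g = S.*-cong (prodS-cong k f≈g) (f≈g k)

prodS-sucˡ : ∀ k f → prodS (suc k) f ≈ f 0 ⊛ prodS k (f ∘ suc)
prodS-sucˡ zero    f = S.*-comm oneS (f 0)
prodS-sucˡ (suc k) f = S.trans (S.*-congʳ (prodS-sucˡ k f)) (S.*-assoc (f 0) (prodS k (f ∘ suc)) (f (suc k)))

prodS-⊛ : ∀ k f g → prodS k f ⊛ prodS k g ≈ prodS k (λ j → f j ⊛ g j)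
prodS-⊛ zero    f g = S.*-identityˡ oneS
prodS-⊛ (suc k) f g = S.trans (*-interchange (prodS k f) (f k) (prodS k g) (g k)) (S.*-congʳ (prodS-⊛ k f g))
  where
  open import Algebra.Properties.CommutativeSemigroup S.*-commutativeSemigroup
    using () renaming (interchange to *-interchange)

private
  module S-Solver = Algebra.Solver.Ring.NaturalCoefficients.Default Series-commutativeSemiring

pochQ : ℕ → Series
pochQ k = prodS k (λ j → oneS ⊕S q^ (suc j))

-- 1 / ((1 - q^(k+1)) ⋯ (1 - q^(2k+1)))
invWindow : ℕ → Series
invWindow k = prodS (suc k) (λ i → geom (k ℕ.+ i))

-- From `k` to `suc k` the window loses 1/(1 - q^(k+1)) and gains 1/(1 - q^(2k+2)) and 1/(1 -
-- q^(2k+3)). `geom-double` turns the lost factor into the first gained one times 1 + q^(k+1), which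
-- joins `pochQ`; the other is the new odd factor.
invQQ2-window : ∀ k → invQQ2 k ≈ pochQ k ⊛ invWindow k
invQQ2-window zero    = S.sym (S.*-identityˡ (invWindow 0))
invQQ2-window (suc k) = begin
  invQQ2 k ⊛ geomOdd (suc k)
    -- `geomOdd j` unfolds to `geom (2 * j)`, and `2 * suc k` computes to `suc k + (suc k + 0)`.
    ≈⟨ S.*-cong (invQQ2-window k) (S.reflexive (cong (λ m → geom (suc k ℕ.+ m)) (ℕ.+-identityʳ (suc k)))) ⟩
  (pochQ k ⊛ invWindow k) ⊛ last
    ≈⟨ S.*-congʳ (S.*-congˡ {pochQ k} (prodS-sucˡ k (λ i → geom (k ℕ.+ i)))) ⟩
  (pochQ k ⊛ (geom (k ℕ.+ 0) ⊛ prodS k (λ i → geom (k ℕ.+ suc i)))) ⊛ last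
    ≈⟨ S.*-congʳ (S.*-congˡ {pochQ k} (S.*-cong
         (S.trans (S.reflexive (cong geom (ℕ.+-identityʳ k))) (geom-double k))
         (prodS-cong k λ i → S.reflexive (cong geom (ℕ.+-suc k i))))) ⟩
  (pochQ k ⊛ (((oneS ⊕S q^ (suc k)) ⊛ geom (k ℕ.+ suc k)) ⊛ common)) ⊛ last
    ≈⟨ solve 5 (λ p x g t l → (p :* ((x :* g) :* t)) :* l := (p :* x) :* ((t :* g) :* l)) S.refl
         (pochQ k) (oneS ⊕S q^ (suc k)) (geom (k ℕ.+ suc k)) common last ⟩
  pochQ (suc k) ⊛ ((common ⊛ geom (k ℕ.+ suc k)) ⊛ last)
    ≈⟨ S.*-congˡ {pochQ (suc k)} (S.*-congʳ (S.*-congˡ {common} (S.reflexive (cong geom (ℕ.+-suc k k))))) ⟩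
  pochQ (suc k) ⊛ invWindow (suc k) ∎
  where
  open SetoidReasoning S.setoid
  open S-Solver
  common = prodS k (λ i → geom (suc k ℕ.+ i))
  last = geom (suc k ℕ.+ suc k)

-- Factors in `χ` and the rewritten summands

z z⁻¹ χ : Series
z = monoS (+ 1) (+ 1) 0
z⁻¹ = monoS (+ 1) (ℤ.- (+ 1)) 0
χ = (oneS ⊕S z) ⊕S z⁻¹

tripleFactor : ℕ → Series
tripleFactor d = oneS ⊕S ((χ ⊛ (q^ d ⊕S (q^ d ⊛ q^ d))) ⊕S (q^ d ⊛ (q^ d ⊛ q^ d)))

tripleFactor-product : ∀ d →
  ((oneS ⊕S q^ d) ⊛ (oneS ⊕S monoS (+ 1) (+ 1) d)) ⊛ (oneS ⊕S monoS (+ 1) (ℤ.- (+ 1)) d)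
    ≈ tripleFactor d
tripleFactor-product d = S.trans
  (S.*-cong
    -- The monomials are split as `z ⊛ q^ d` and `z⁻¹ ⊛ q^ d` to match `triple-product`.
    (S.*-congˡ {oneS ⊕S q^ d} (S.+-congˡ {oneS} (S.sym (monoS-⊛-monoS (+ 1) (+ 1) 0 (+ 1) (+ 0) d))))
    (S.+-congˡ {oneS} (S.sym (monoS-⊛-monoS (+ 1) (ℤ.- (+ 1)) 0 (+ 1) (+ 0) d))))
  (triple-product Series-commutativeSemiring (q^ d)
    (S.trans (monoS-⊛-monoS (+ 1) (+ 1) 0 (+ 1) (ℤ.- (+ 1)) 0) (S.sym oneS≈monoS)))

-- The factors 1 + q^j released by `invQQ2-window` are essential to the form: without them the
-- middle coefficient would be z + z⁻¹ in place of `χ`.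
summand-product : ∀ k →
  summand k ≈ prodS k (λ j → tripleFactor (suc j)) ⊛ (q^ k ⊛ invWindow k)
summand-product k = begin
  ((pochPlusZ k ⊛ pochMinusZ k) ⊛ q^ k) ⊛ invQQ2 k
    ≈⟨ S.*-congˡ {(pochPlusZ k ⊛ pochMinusZ k) ⊛ q^ k} (invQQ2-window k) ⟩
  ((pochPlusZ k ⊛ pochMinusZ k) ⊛ q^ k) ⊛ (pochQ k ⊛ invWindow k)
    ≈⟨ solve 5 (λ p m x d w → ((p :* m) :* x) :* (d :* w) := ((d :* p) :* m) :* (x :* w)) S.refl
         (pochPlusZ k) (pochMinusZ k) (q^ k) (pochQ k) (invWindow k) ⟩
  ((pochQ k ⊛ pochPlusZ k) ⊛ pochMinusZ k) ⊛ (q^ k ⊛ invWindow k)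
    ≈⟨ S.*-congʳ (S.trans (S.*-congʳ (prodS-⊛ k _ _)) (S.trans (prodS-⊛ k _ _)
         (prodS-cong k λ j → tripleFactor-product (suc j)))) ⟩
  prodS k (λ j → tripleFactor (suc j)) ⊛ (q^ k ⊛ invWindow k) ∎
  where
  open SetoidReasoning S.setoid
  open S-Solver

-- Radially decreasing sequences

-- Strictness is asked at distance two, not one: multiplication by `χ` turns the sequence of 1 into
-- 1, 1, 1. Evenness carries the conditions to negative indices.
record Radial (a : ℤ → ℤ) : Set where
  field
    even   : ∀ i → a (ℤ.- i) ≡ a i
    nonneg : ∀ n → + 0 ℤ.≤ a (+ n)
    step   : ∀ n → a (+ suc n) ℤ.≤ a (+ n)
    gap    : ∀ n → a (+ n) ≢ + 0 → a (+ suc (suc n)) < a (+ n)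

  step² : ∀ n → a (+ suc (suc n)) ℤ.≤ a (+ n)
  step² n = ℤ.≤-trans (step (suc n)) (step n)

  vanish : ∀ n → a (+ n) ≡ + 0 → a (+ suc n) ≡ + 0
  vanish n an≡0 = ℤ.≤-antisym (ℤ.≤-trans (step n) (ℤ.≤-reflexive an≡0)) (nonneg (suc n))

  antitone : ∀ {m n} → m ℕ.≤ n → a (+ n) ℤ.≤ a (+ m)
  antitone m≤n = go (ℕ.≤⇒≤′ m≤n)
    where
    go : ∀ {m n} → m ℕ.≤′ n → a (+ n) ℤ.≤ a (+ m)
    go ℕ.≤′-refl       = ℤ.≤-refl
    go (ℕ.≤′-step m≤n) = ℤ.≤-trans (step _) (go m≤n)

open Radial

Radial-resp : ∀ {a b} → (∀ i → a i ≡ b i) → Radial a → Radial b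
Radial-resp {a} {b} a≗b ra = record
  { even   = λ i → trans (sym (a≗b (ℤ.- i))) (trans (even ra i) (a≗b i))
  ; nonneg = λ n → subst (+ 0 ℤ.≤_) (a≗b (+ n)) (nonneg ra n)
  ; step   = λ n → cast ℤ._≤_ (+ suc n) (+ n) (step ra n)
  ; gap    = λ n bn≢0 → cast _<_ (+ suc (suc n)) (+ n) (gap ra n (bn≢0 ∘ trans (sym (a≗b (+ n)))))
  }
  where
  cast : (_∼_ : ℤ → ℤ → Set) → ∀ i j → a i ∼ a j → b i ∼ b j
  cast _∼_ i j = subst (λ x → x) (cong₂ _∼_ (a≗b i) (a≗b j))

Radial-0 : Radial (λ _ → + 0)
Radial-0 = record
  { even = λ _ → refl ; nonneg = λ _ → ℤ.≤-refl ; step = λ _ → ℤ.≤-refl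
  ; gap = λ _ 0≢0 → contradiction refl 0≢0 }

Radial-+ : ∀ {a b} → Radial a → Radial b → Radial (λ i → a i ℤ.+ b i)
Radial-+ {a} {b} ra rb = record
  { even   = λ i → cong₂ ℤ._+_ (even ra i) (even rb i)
  ; nonneg = λ n → ℤ.+-mono-≤ (nonneg ra n) (nonneg rb n)
  ; step   = λ n → ℤ.+-mono-≤ (step ra n) (step rb n)
  ; gap    = gap-+
  }
  where
  gap-+ : ∀ n → a (+ n) ℤ.+ b (+ n) ≢ + 0 →
    a (+ suc (suc n)) ℤ.+ b (+ suc (suc n)) < a (+ n) ℤ.+ b (+ n)
  -- At least one of the two values is nonzero and drops strictly; the other drops weakly by
  -- `step²`.
  gap-+ n sum≢0 with a (+ n) ℤ.≟ + 0
  ... | no an≢0  = ℤ.+-mono-<-≤ (gap ra n an≢0) (step² rb n)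
  ... | yes an≡0 = ℤ.+-mono-≤-< (step² ra n) (gap rb n λ bn≡0 → sum≢0 (cong₂ ℤ._+_ an≡0 bn≡0))

δ : ℤ → ℤ
δ i = if does (i ℤ.≟ + 0) then + 1 else + 0

Radial-δ : Radial δ
Radial-δ = record { even = even-δ ; nonneg = nonneg-δ ; step = step-δ ; gap = gap-δ }
  where
  even-δ : ∀ i → δ (ℤ.- i) ≡ δ i
  even-δ (+ zero)  = refl
  even-δ (+ suc n) = refl
  even-δ -[1+ n ]  = refl
  nonneg-δ : ∀ n → + 0 ℤ.≤ δ (+ n)
  nonneg-δ zero    = ℤ.+≤+ z≤n
  nonneg-δ (suc n) = ℤ.+≤+ z≤n
  step-δ : ∀ n → δ (+ suc n) ℤ.≤ δ (+ n)
  step-δ zero    = ℤ.+≤+ z≤n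
  step-δ (suc n) = ℤ.+≤+ z≤n
  gap-δ : ∀ n → δ (+ n) ≢ + 0 → δ (+ suc (suc n)) < δ (+ n)
  gap-δ zero    _   = ℤ.+<+ (s≤s z≤n)
  gap-δ (suc n) 0≢0 = contradiction refl 0≢0

-- The middle term a i is essential: a ↦ a (i - 1) + a (i + 1) does not preserve Radial.
Radial-smear : ∀ {a} → Radial a → Radial (λ i → a i ℤ.+ (a (ℤ.pred i) ℤ.+ a (ℤ.suc i)))
Radial-smear {a} ra = record
  { even = even-b ; nonneg = nonneg-b ; step = step-b ; gap = gap-b }
  where
  b : ℤ → ℤ
  b i = a i ℤ.+ (a (ℤ.pred i) ℤ.+ a (ℤ.suc i))

  even-b : ∀ i → b (ℤ.- i) ≡ b i
  even-b i = cong₂ ℤ._+_ (even ra i) (trans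
    (cong₂ ℤ._+_ (trans (cong a (sym (ℤ.neg-distrib-+ (+ 1) i))) (even ra (ℤ.suc i)))
                 (trans (cong a (sym (ℤ.neg-distrib-+ -[1+ 0 ] i))) (even ra (ℤ.pred i))))
    (ℤ.+-comm (a (ℤ.suc i)) (a (ℤ.pred i))))

  -- At 0 the left neighbour has index -1 and is reflected by evenness; hence the separate zero
  -- cases below.
  b-zero : b (+ 0) ≡ a (+ 0) ℤ.+ (a (+ 1) ℤ.+ a (+ 1))
  b-zero = cong (λ x → a (+ 0) ℤ.+ (x ℤ.+ a (+ 1))) (even ra (+ 1))

  nonneg-b : ∀ n → + 0 ℤ.≤ b (+ n)
  nonneg-b zero = subst (+ 0 ℤ.≤_) (sym b-zero)
    (ℤ.+-mono-≤ (nonneg ra 0) (ℤ.+-mono-≤ (nonneg ra 1) (nonneg ra 1)))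
  nonneg-b (suc n) =
    ℤ.+-mono-≤ (nonneg ra (suc n)) (ℤ.+-mono-≤ (nonneg ra n) (nonneg ra (suc (suc n))))

  swapˡ : ∀ x y t → x ℤ.+ (y ℤ.+ t) ≡ y ℤ.+ (x ℤ.+ t)
  swapˡ = ℤSolver.solve-∀

  step-b : ∀ n → b (+ suc n) ℤ.≤ b (+ n)
  -- The neighbour `a (+ 0)` of index 1 is matched with the middle term at index 0, so only
  -- `a (+ 2) ≤ a (+ 1)` is left.
  step-b zero = begin
    a (+ 1) ℤ.+ (a (+ 0) ℤ.+ a (+ 2))   ≡⟨ swapˡ (a (+ 1)) (a (+ 0)) (a (+ 2)) ⟩
    a (+ 0) ℤ.+ (a (+ 1) ℤ.+ a (+ 2))
      ≤⟨ ℤ.+-monoʳ-≤ (a (+ 0)) (ℤ.+-monoʳ-≤ (a (+ 1)) (step ra 1)) ⟩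
    a (+ 0) ℤ.+ (a (+ 1) ℤ.+ a (+ 1))   ≡⟨ b-zero ⟨
    b (+ 0)                             ∎
    where open ℤ.≤-Reasoning
  step-b (suc n) = ℤ.+-mono-≤ (step ra (suc n)) (ℤ.+-mono-≤ (step ra n) (step ra (suc (suc n))))

  gap-b : ∀ n → b (+ n) ≢ + 0 → b (+ suc (suc n)) < b (+ n)
  gap-b zero b0≢0 = subst (b (+ 2) <_) (sym b-zero)
    (ℤ.+-mono-<-≤ (gap ra 0 a0≢0) (ℤ.+-monoʳ-≤ (a (+ 1)) (step² ra 1)))
    where
    a0≢0 : a (+ 0) ≢ + 0
    a0≢0 a0≡0 = b0≢0 (trans b-zero
      (cong₂ ℤ._+_ a0≡0 (cong₂ ℤ._+_ (vanish ra 0 a0≡0) (vanish ra 0 a0≡0))))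
  -- Of the three terms of `b (+ suc n)` the innermost, `a (+ n)`, is the largest. If it vanished,
  -- all would, so the strict drop is taken from it.
  gap-b (suc n) bn≢0 =
    ℤ.+-mono-≤-< (step² ra (suc n)) (ℤ.+-mono-<-≤ (gap ra n an≢0) (step² ra (suc (suc n))))
    where
    an≢0 : a (+ n) ≢ + 0
    an≢0 an≡0 = bn≢0 (cong₂ ℤ._+_ (vanish ra n an≡0)
      (cong₂ ℤ._+_ an≡0 (vanish ra (suc n) (vanish ra n an≡0))))

-- Laurent polynomials acting on radial sequences

-- The coefficient sequence of p ⊗ r is act p applied to that of r.
act : LPoly → (ℤ → ℤ) → ℤ → ℤ
act p a m = ⟨ p , (λ e → a (m ℤ.- e)) ⟩

-- `δ` is the coefficient sequence of 1. `coeffZ` decides `e ≡ m` where `δ` decides `m - e ≡ + 0`;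
-- these are equivalent, so the two Booleans agree.
coeffZ≡act : ∀ p m → coeffZ m p ≡ act p δ m
coeffZ≡act []            m = refl
coeffZ≡act ((e , c) ∷ p) m = cong₂ ℤ._+_ (head (does-⇔ e≡m⇔m-e≡0 (e ℤ.≟ m) (m ℤ.- e ℤ.≟ + 0))) (coeffZ≡act p m)
  where
  e≡m⇔m-e≡0 : e ≡ m ⇔ m ℤ.- e ≡ + 0
  e≡m⇔m-e≡0 = mk⇔ (λ e≡m → ℤ.i≡j⇒i-j≡0 (sym e≡m)) (λ eq → sym (ℤ.i-j≡0⇒i≡j m e eq))
  head : ∀ {b b′} → b ≡ b′ → (if b then c else + 0) ≡ c ℤ.* (if b′ then + 1 else + 0)
  head {true}  refl = sym (ℤ.*-identityʳ c)
  head {false} refl = sym (ℤ.*-zeroʳ c)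

-- A property of the operator rather than of the coefficients: closure under `⊗` is then
-- composition, and no convolution of two radial sequences has to be analysed.
Preserving : LPoly → Set
Preserving p = ∀ {a} → Radial a → Radial (act p a)

Preserving-resp : ∀ {p r} → p ≋ r → Preserving p → Preserving r
Preserving-resp p≋r pp ra = Radial-resp (λ m → pairing p≋r _) (pp ra)

Preserving-[] : Preserving []
Preserving-[] _ = Radial-0

Preserving-1 : Preserving [ + 0 , + 1 ]
Preserving-1 {a} ra = Radial-resp
  (λ m → sym (trans (pair-1 (λ e → a (m ℤ.- e))) (cong a (ℤ.+-identityʳ m)))) ra

-- The exponents 0, 1 and -1 move `m` to `m`, `pred m` and `suc m`, which is the sum in
-- `Radial-smear`.
Preserving-χ : Preserving (χ 0)
Preserving-χ {a} ra = Radial-resp (λ m → sym (expand m)) (Radial-smear ra)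
  where
  expand : ∀ m → act (χ 0) a m ≡ a m ℤ.+ (a (ℤ.pred m) ℤ.+ a (ℤ.suc m))
  expand m = cong₂ ℤ._+_ (term (+ 0) (ℤ.+-identityʳ m))
    (cong₂ ℤ._+_ (term (+ 1) (ℤ.+-comm m -[1+ 0 ]))
      (trans (ℤ.+-identityʳ _) (term -[1+ 0 ] (ℤ.+-comm m (+ 1)))))
    where
    term : ∀ e {i} → m ℤ.- e ≡ i → + 1 ℤ.* a (m ℤ.- e) ≡ a i
    term e eq = trans (ℤ.*-identityˡ _) (cong a eq)

Preserving-++ : ∀ {p r} → Preserving p → Preserving r → Preserving (p ++ r)
Preserving-++ {p} {r} pp pr ra = Radial-resp (λ m → sym (pair-++ p r _)) (Radial-+ (pp ra) (pr ra))

Preserving-⊗ : ∀ {p r} → Preserving p → Preserving r → Preserving (p ⊗ r)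
Preserving-⊗ {p} {r} pp pr {a} ra = Radial-resp (λ m → sym (act-⊗ m)) (pp (pr ra))
  where
  regroup : ∀ m e e′ → m ℤ.- (e ℤ.+ e′) ≡ (m ℤ.- e) ℤ.- e′
  regroup = ℤSolver.solve-∀
  act-⊗ : ∀ m → act (p ⊗ r) a m ≡ act p (act r a) m
  act-⊗ m = trans (pair-⊗ p r _) (pair-cong p λ e → pair-cong r λ e′ → cong a (regroup m e e′))

Preserving-sumTo : ∀ n {f} → (∀ i → Preserving (f i)) → Preserving (sumTo n f)
Preserving-sumTo n {f} pf = go (upTo (suc n))
  where
  go : ∀ is → Preserving (foldr (λ i acc → f i ++ acc) [] is)
  go []       = Preserving-[]
  go (i ∷ is) = Preserving-++ {f i} (pf i) (go is)

PreservingS : Series → Set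
PreservingS f = ∀ n → Preserving (f n)

PreservingS-⊕ : ∀ {f g} → PreservingS f → PreservingS g → PreservingS (f ⊕S g)
PreservingS-⊕ {f} pf pg n = Preserving-++ {f n} (pf n) (pg n)

PreservingS-⊛ : ∀ {f g} → PreservingS f → PreservingS g → PreservingS (f ⊛ g)
PreservingS-⊛ {f} {g} pf pg n =
  Preserving-sumTo n {λ i → f i ⊗ g (n ℕ.∸ i)} λ i → Preserving-⊗ {f i} {g (n ℕ.∸ i)} (pf i) (pg (n ℕ.∸ i))

PreservingS-one : PreservingS oneS
PreservingS-one zero    = Preserving-1
PreservingS-one (suc n) = Preserving-[]

PreservingS-prodS : ∀ k {f} → (∀ j → PreservingS (f j)) → PreservingS (prodS k f)
PreservingS-prodS zero        pf = PreservingS-one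
PreservingS-prodS (suc k) {f} pf = PreservingS-⊛ {prodS k f} (PreservingS-prodS k pf) (pf k)

-- Covers the powers of q and the geometric series at once.
PreservingS-indicator : ∀ (b : ℕ → Bool) → PreservingS (λ n → if b n then [ + 0 , + 1 ] else [])
PreservingS-indicator b n with b n
... | true  = Preserving-1
... | false = Preserving-[]

PreservingS-q^ : ∀ d → PreservingS (q^ d)
PreservingS-q^ d = PreservingS-indicator (λ n → does (n ℕ.≟ d))

PreservingS-χ : PreservingS χ
PreservingS-χ zero    = Preserving-χ
PreservingS-χ (suc n) = Preserving-[]

PreservingS-tripleFactor : ∀ d → PreservingS (tripleFactor d)
PreservingS-tripleFactor d =
  PreservingS-⊕ {oneS} PreservingS-one
    (PreservingS-⊕ {χ ⊛ (q^ d ⊕S q²)}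
      (PreservingS-⊛ {χ} {q^ d ⊕S q²} PreservingS-χ (PreservingS-⊕ {q^ d} (PreservingS-q^ d) pq²))
      (PreservingS-⊛ {q^ d} (PreservingS-q^ d) pq²))
  where
  q² = q^ d ⊛ q^ d
  pq² : PreservingS q²
  pq² = PreservingS-⊛ {q^ d} (PreservingS-q^ d) (PreservingS-q^ d)

-- The defining product cannot be treated factor by factor, since multiplication by z destroys
-- evenness; the product in `summand-product` can.
PreservingS-summand : ∀ k → PreservingS (summand k)
PreservingS-summand k n = Preserving-resp (L.sym (at (summand-product k) n))
  (PreservingS-⊛ {prodS k (λ j → tripleFactor (suc j))} {q^ k ⊛ invWindow k}
    (PreservingS-prodS k λ j → PreservingS-tripleFactor (suc j))
    (PreservingS-⊛ {q^ k} {invWindow k} (PreservingS-q^ k)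
      (PreservingS-prodS (suc k) λ i → PreservingS-indicator (λ n → does ((n % suc (k ℕ.+ i)) ℕ.≟ 0))))
    n)

-- Symmetry, unimodality and strict decrease for `u-ob`

Radial-u-ob : ∀ n → Radial (λ m → u-ob m n)
Radial-u-ob n = Radial-resp (λ m → sym (coeffZ≡act (genFun n) m))
  (Preserving-sumTo n {λ k → summand k n} (λ k → PreservingS-summand k n) Radial-δ)

Radial⇒Unimodal : ∀ {a} → Radial a → Unimodal a
-- The peak is at 0, and the rising side is the falling side reflected by evenness.
Radial⇒Unimodal {a} ra = + 0 , λ i j _ _ i≤j → rising i≤j , falling i≤j
  where
  falling : ∀ {i j} → i ℤ.≤ j → + 0 ℤ.≤ i → a j ℤ.≤ a i
  falling (ℤ.+≤+ i≤j) (ℤ.+≤+ _) = antitone ra i≤j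

  rising : ∀ {i j} → i ℤ.≤ j → j ℤ.≤ + 0 → a i ℤ.≤ a j
  rising i≤j j≤0 = subst (λ x → x) (cong₂ ℤ._≤_ (even ra _) (even ra _))
    (falling (ℤ.neg-mono-≤ i≤j) (ℤ.neg-mono-≤ j≤0))

theorem4p10 : ((n : ℕ) → Symmetric (λ m → u-ob m n) × Unimodal (λ m → u-ob m n))
    × ((m n : ℕ) → ¬ u-ob (+ m) n ≡ + 0 → u-ob (+ (m +ℕ 2)) n < u-ob (+ m) n)
theorem4p10 =
    (λ n → (λ m → sym (even (Radial-u-ob n) m)) , Radial⇒Unimodal (Radial-u-ob n))
  -- `gap` speaks of `suc (suc m)`, that is `2 + m`, and the goal of `m + 2`.
  , (λ m n u≢0 → subst (λ k → u-ob (+ k) n < u-ob (+ m) n) (ℕ.+-comm 2 m) (gap (Radial-u-ob n) m u≢0))
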